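{- Let $k$ be a positive integer, write $[k]=\{1,\dots,k\}$, and for each natural number $n$ (including $n=0$) let $g_1(n), g_2(n), \dots, g_k(n)$ be impartial games. For every $i\in[k]$ let $S_i$ be a subset of $[k]\times[k]$. Suppose that for all $n$ and all $i\in[k]$, every playable move on $g_i(n)$ is denoted by a quadruple $(p,q,a,b)$ and splits the game into $g_p(a)$ and $g_q(b)$ (that is, it results in the disjunctive sum $g_p(a)+g_q(b)$), where $(p,q)\in S_i$, $a$ and $b$ are non-negative integers, and $a+b+1=n$. Let $s\ge T$ be positive integers. Suppose further that for every $i\in[k]$ and every $(p,q)\in S_i$: 1. For all integers $a,b\ge s-T$ with $a,b\geq 0$, the move $(p,q,a,b)$ is valid on $g_i(n)$ for $n=a+b+1$. 2. For every integer $a$ with $0\le a<s-T$: if there is some $n$ with $n-a-1\ge s-T$ such that the move $(p,q,a,n-a-1)$ is invalid on $g_i(n)$, then the move $(p,q,a,m-a-1)$ is invalid on $g_i(m)$ for all natural numbers $m$. 3. For every integer $b$ with $0\le b<s-T$: if there is some $n$ with $n-b-1\ge s-T$ such that the move $(p,q,n-b-1,b)$ is invalid on $g_i(n)$, then the move $(p,q,m-b-1,b)$ is invalid on $g_i(m)$ for all natural numbers $m$. Finally, suppose that for all integers $n\in[s+1,2s+1]$ and all $i\in[k]$, $\mathrm{Nim}(g_i(n))=\mathrm{Nim}(g_i(n-T))$. Then $\mathrm{Nim}(g_i(n))=\mathrm{Nim}(g_i(n-T))$ for all integers $n\ge s+1$ and all $i\in[k]$.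
   Context: Games are finite impartial games under normal play (two players alternate; a player unable to move loses). $\mathrm{Nim}(G)$ denotes the Nimber (Sprague–Grundy value) of $G$: the mex (minimum excluded non-negative integer) of the set of Nimbers of all positions reachable from $G$ in one move; a game with no moves has Nimber $0$. The Nimber of a disjunctive sum of two games is the bitwise xor of their Nimbers. For $(p,q)\in S_i$ and non-negative integers $a,b$ with $a+b+1=n$, the quadruple $(p,q,a,b)$ is called valid (or playable) on $g_i(n)$ if there is a legal move in $g_i(n)$ whose result is $g_p(a)+g_q(b)$ denoted by this quadruple, and invalid otherwise. Every legal move of $g_i(n)$ is given by such a quadruple. -}

module Defs where

open import Level using (0ℓ)
open import Data.Nat using (ℕ; suc; _+_; _<_)
open import Data.Nat.Properties using (n<1+n; _≟_)
open import Data.Fin using (Fin; toℕ; fromℕ<; splitAt)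
open import Data.Fin.Properties
  using (any?; pigeonhole; ¬∀⟶∃¬-smallest; toℕ-fromℕ<; toℕ-inject; <⇒≢; toℕ-injective)
open import Data.Product using (∃; ∃₂; _×_; _,_; proj₁; proj₂)
open import Data.Sum using ([_,_]′)
open import Data.Vec.Functional using (Vector)
open import Function using (_∘_)
open import Relation.Binary.PropositionalEquality using (_≡_; _≢_; sym; trans; cong)
open import Relation.Nullary using (¬_)
open import Relation.Unary using (Pred; _∈_)

-- A finite impartial game: m legal moves and the position each leads to.
data Game : Set where
  game : (m : ℕ) → Vector Game m → Game

#moves : Game → ℕ
#moves (game m _) = m

Move : Game → Set
Move G = Fin (#moves G)

result : (G : Game) → Move G → Game
result (game _ f) = f

-- Identity of game trees, regardless of the order and multiplicity in which
-- options are listed.  This is finer than equality of Nimbers.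
infix 4 _≅_
_≅_ : Game → Game → Set
game m f ≅ game n h =
  (∀ i → ∃ λ j → f i ≅ h j) × (∀ j → ∃ λ i → f i ≅ h j)

-- Disjunctive sum.
infixl 6 _⊕_
_⊕_ : Game → Game → Game
G@(game m f) ⊕ H@(game n h) =
  game (m + n) λ x → [ (λ i → f i ⊕ H) , (λ j → G ⊕ h j) ]′ (splitAt m x)

IsMex : ∀ {m} → Vector ℕ m → ℕ → Set
IsMex f x = (∀ i → f i ≢ x) × (∀ y → y < x → ∃ λ i → f i ≡ y)

mex-exists : ∀ {m} (f : Vector ℕ m) → ∃ (IsMex f)
mex-exists {m} f with ¬∀⟶∃¬-smallest (suc m) Hit (λ j → any? λ i → f i ≟ toℕ j) ¬all
  where
  Hit : Pred (Fin (suc m)) 0ℓ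
  Hit j = ∃ λ i → f i ≡ toℕ j

  ¬all : ¬ (∀ j → Hit j)
  ¬all hit with pigeonhole (n<1+n m) (proj₁ ∘ hit)
  ... | j , j′ , j<j′ , eq = <⇒≢ j<j′ (toℕ-injective
    (trans (sym (proj₂ (hit j))) (trans (cong f eq) (proj₂ (hit j′)))))
... | x , miss , below = toℕ x , (λ i eq → miss (i , eq)) , λ y y<x →
  let i , eq = below (fromℕ< y<x)
  in i , trans eq (trans (toℕ-inject (fromℕ< y<x)) (toℕ-fromℕ< y<x))

mex : ∀ {m} → Vector ℕ m → ℕ
mex f = proj₁ (mex-exists f)

Nim : Game → ℕ
Nim (game _ f) = mex λ i → Nim (f i)

-- The denotation of moves is part of the data: a quadruple may be invalid on
-- g i n even if the tree of g p a ⊕ g q b happens to coincide with that of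
-- some option of g i n.  It is a relation, since one move may have several
-- names, e.g. (p , q , a , b) and (q , p , b , a).
record SplittingMoves {k : ℕ} (g : Fin k → ℕ → Game)
                      (S : Fin k → Pred (Fin k × Fin k) 0ℓ) : Set₁ where
  field
    Denotes : ∀ i n → Move (g i n) → Fin k → Fin k → ℕ → ℕ → Set
    denoted : ∀ i n (μ : Move (g i n)) →
      ∃₂ λ p q → ∃₂ λ a b → Denotes i n μ p q a b
    splits  : ∀ i n (μ : Move (g i n)) p q a b → Denotes i n μ p q a b →
      (p , q) ∈ S i × a + b + 1 ≡ n × result (g i n) μ ≅ g p a ⊕ g q b

  Valid : Fin k → ℕ → Fin k → Fin k → ℕ → ℕ → Set
  Valid i n p q a b = ∃ λ μ → Denotes i n μ p q a b

{-# OPTIONS --safe #-}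
-- Sums respect Nimbers, so replacing a summand by one of equal Nimber does not
-- change the Nimber of an option.  For n > 2s + 1 every option of g i n and of
-- g i (n ∸ T) has a large summand; shifting its index by T preserves its Nimber
-- by strong induction and its validity by the three hypotheses, so both games
-- have the same set of option Nimbers.
module Submission where

open import Defs
open import Level using (0ℓ)
open import Data.Nat using (ℕ; _+_; _*_; _∸_; _≤_; _<_; suc; s≤s)
open import Data.Nat.Properties
open import Data.Nat.Induction using (<-rec)
open import Data.Nat.Tactic.RingSolver using (solve-∀)
open import Data.Fin using (Fin; splitAt; _↑ˡ_; _↑ʳ_)
open import Data.Fin.Properties using (splitAt-↑ˡ; splitAt-↑ʳ)
open import Data.Product using (∃; _×_; _,_; ∃₂; proj₁; proj₂)
open import Data.Sum using (_⊎_; inj₁; inj₂; [_,_]′)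
open import Function using (_∘_)
open import Relation.Binary.PropositionalEquality
  using (_≡_; _≢_; refl; sym; trans; cong; subst)
open import Relation.Nullary using (¬_; yes; no)
open import Relation.Unary using (Pred; _∈_)

-- Nimbers of options and of identical trees.

Nim-result≢Nim : ∀ G (μ : Move G) → Nim (result G μ) ≢ Nim G
Nim-result≢Nim (game _ f) = proj₁ (proj₂ (mex-exists (Nim ∘ f)))

Nim-reachable : ∀ G {y} → y < Nim G → ∃ λ μ → Nim (result G μ) ≡ y
Nim-reachable (game _ f) = proj₂ (proj₂ (mex-exists (Nim ∘ f))) _

-- The double negation is harmless, as the order on ℕ is stable; it is needed
-- since validity of moves is not assumed decidable.
Nim-⊆ : ∀ G H →
  (∀ μ → ¬ ¬ ∃ λ ν → Nim (result G μ) ≡ Nim (result H ν)) → Nim G ≤ Nim H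
Nim-⊆ G H sub = ≮⇒≥ λ H<G →
  let μ , eq = Nim-reachable G H<G
  in sub μ λ (ν , eq′) → Nim-result≢Nim H ν (trans (sym eq′) eq)

Nim-resp-≅ : ∀ G H → G ≅ H → Nim G ≡ Nim H
Nim-resp-≅ G@(game _ f) H@(game _ h) (to , from) = ≤-antisym
  (Nim-⊆ G H λ i ¬∃ → let j , eq = to i in
    ¬∃ (j , Nim-resp-≅ (f i) (h j) eq))
  (Nim-⊆ H G λ j ¬∃ → let i , eq = from j in
    ¬∃ (i , sym (Nim-resp-≅ (f i) (h j) eq)))

-- Nimbers of disjunctive sums, from the mex property alone.

⊕-moveˡ : ∀ G H (μ : Move G) → ∃ λ ν → result (G ⊕ H) ν ≡ result G μ ⊕ H
⊕-moveˡ (game m f) (game n h) μ = μ ↑ˡ n , cong [ _ , _ ]′ (splitAt-↑ˡ m μ n)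

⊕-moveʳ : ∀ G H (μ : Move H) → ∃ λ ν → result (G ⊕ H) ν ≡ G ⊕ result H μ
⊕-moveʳ (game m f) (game n h) μ = m ↑ʳ μ , cong [ _ , _ ]′ (splitAt-↑ʳ m n μ)

⊕-move⁻¹ : ∀ G H (ν : Move (G ⊕ H)) →
  (∃ λ μ → result (G ⊕ H) ν ≡ result G μ ⊕ H) ⊎
  (∃ λ μ → result (G ⊕ H) ν ≡ G ⊕ result H μ)
⊕-move⁻¹ (game m _) (game n _) ν with splitAt m ν
... | inj₁ μ = inj₁ (μ , refl)
... | inj₂ μ = inj₂ (μ , refl)

-- Each option is matched with the same move made in the swapped sum. Commutativity serves to carry
-- congruence from the left summand to the right one.
Nim-⊕-comm-≤ : ∀ G H → Nim (G ⊕ H) ≤ Nim (H ⊕ G)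
Nim-⊕-comm   : ∀ G H → Nim (G ⊕ H) ≡ Nim (H ⊕ G)

Nim-⊕-comm-≤ G@(game _ f) H@(game _ h) = Nim-⊆ (G ⊕ H) (H ⊕ G) λ ν ¬∃ →
  [ (λ (μ , eq) → let ν′ , eq′ = ⊕-moveʳ H G μ in ¬∃ (ν′ ,
      trans (cong Nim eq) (trans (Nim-⊕-comm (f μ) H) (cong Nim (sym eq′)))))
  , (λ (μ , eq) → let ν′ , eq′ = ⊕-moveˡ H G μ in ¬∃ (ν′ ,
      trans (cong Nim eq) (trans (Nim-⊕-comm G (h μ)) (cong Nim (sym eq′)))))
  ]′ (⊕-move⁻¹ G H ν)

Nim-⊕-comm G H = ≤-antisym (Nim-⊕-comm-≤ G H) (Nim-⊕-comm-≤ H G)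

-- Congruence and cancellation feed each other: an option of A′ ⊕ B equivalent
-- to A ⊕ B would, by cancellation, be the sum of B with an option of A′
-- equivalent to A.
Nim-⊕-≮ : ∀ A A′ B → Nim A ≡ Nim A′ → ¬ Nim (A ⊕ B) < Nim (A′ ⊕ B)
Nim-⊕-congʳ : ∀ A A′ B → Nim A ≡ Nim A′ → Nim (A ⊕ B) ≡ Nim (A′ ⊕ B)
Nim-⊕-≢ : ∀ A G B → Nim A < Nim G → Nim (A ⊕ B) ≢ Nim (G ⊕ B)
Nim-⊕-cancelʳ : ∀ A G B → Nim (A ⊕ B) ≡ Nim (G ⊕ B) → Nim A ≡ Nim G

Nim-⊕-≮ A A′@(game _ f) B@(game _ h) eq lt =
  let ν , hit = Nim-reachable (A′ ⊕ B) lt in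
  [ (λ (μ , r) → Nim-result≢Nim A′ μ
      (trans (sym (Nim-⊕-cancelʳ A (f μ) B (trans (sym hit) (cong Nim r)))) eq))
  -- A move in `B` can be copied in `A ⊕ B`, where it would reach an option with the Nimber of
  -- `A ⊕ B` itself.
  , (λ (μ , r) → let ν′ , r′ = ⊕-moveʳ A B μ in Nim-result≢Nim (A ⊕ B) ν′
      (trans (cong Nim r′)
        (trans (Nim-⊕-congʳ A A′ (h μ) eq) (trans (sym (cong Nim r)) hit))))
  ]′ (⊕-move⁻¹ A′ B ν)

Nim-⊕-congʳ A A′ B eq = ≤-antisym
  (≮⇒≥ (Nim-⊕-≮ A′ A B (sym eq))) (≮⇒≥ (Nim-⊕-≮ A A′ B eq))

Nim-⊕-≢ A G@(game _ f) B A<G eq =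
  -- `G` has an option with the Nimber of `A`; under `eq` its sum with `B` would be an option of
  -- `G ⊕ B` with the Nimber of `G ⊕ B`.
  let μ , hit = Nim-reachable G A<G
      ν , r   = ⊕-moveˡ G B μ
  in Nim-result≢Nim (G ⊕ B) ν
       (trans (cong Nim r) (trans (Nim-⊕-congʳ (f μ) A B hit) eq))

Nim-⊕-cancelʳ A G B eq = ≤-antisym
  (≮⇒≥ λ G<A → Nim-⊕-≢ G A B G<A (sym eq)) (≮⇒≥ λ A<G → Nim-⊕-≢ A G B A<G eq)

Nim-⊕-congˡ : ∀ A B B′ → Nim B ≡ Nim B′ → Nim (A ⊕ B) ≡ Nim (A ⊕ B′)
Nim-⊕-congˡ A B B′ eq =
  trans (Nim-⊕-comm A B) (trans (Nim-⊕-congʳ B B′ A eq) (Nim-⊕-comm B′ A))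

-- Shifting the indices of a move.

+-<-split : ∀ {m n} a b → m + n < a + b → m < a ⊎ n < b
+-<-split {m} {n} a b lt with m <? a
... | yes m<a = inj₁ m<a
... | no  m≮a = inj₂ (+-cancelˡ-< m n b (<-≤-trans lt (+-monoˡ-≤ b (≮⇒≥ m≮a))))

+-rotateˡ : ∀ a b t → (a + t) + b + 1 ≡ (a + b + 1) + t
+-rotateˡ = solve-∀

+-rotateʳ : ∀ a b t → a + (b + t) + 1 ≡ (a + b + 1) + t
+-rotateʳ = solve-∀

-- The threshold `s ∸ T` is abstracted to `u`, so that `s` becomes `u + T`.
module Shift
  {k : ℕ} {g : Fin k → ℕ → Game} {S : Fin k → Pred (Fin k × Fin k) 0ℓ}
  (M : SplittingMoves g S)
  (u : ℕ)
  (valid-large : ∀ i p q → (p , q) ∈ S i → ∀ a b → u ≤ a → u ≤ b →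
    SplittingMoves.Valid M i (a + b + 1) p q a b)
  (invalid-smallˡ : ∀ i p q → (p , q) ∈ S i → ∀ a → a < u →
    (∃₂ λ n b → a + b + 1 ≡ n × u ≤ b × ¬ SplittingMoves.Valid M i n p q a b) →
    ∀ m b → a + b + 1 ≡ m → ¬ SplittingMoves.Valid M i m p q a b)
  (invalid-smallʳ : ∀ i p q → (p , q) ∈ S i → ∀ b → b < u →
    (∃₂ λ n a → a + b + 1 ≡ n × u ≤ a × ¬ SplittingMoves.Valid M i n p q a b) →
    ∀ m a → a + b + 1 ≡ m → ¬ SplittingMoves.Valid M i m p q a b)
  where

  open SplittingMoves M

  -- If `b` is small, invalidity at the large index `a′` would spread to all first indices and
  -- contradict `v`; otherwise both indices are large. The double negation arises because the
  -- small-index hypotheses transfer only invalidity.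
  valid-shiftˡ : ∀ {i p q a a′ b} → (p , q) ∈ S i → u ≤ a′ →
    Valid i (a + b + 1) p q a b → ¬ ¬ Valid i (a′ + b + 1) p q a′ b
  valid-shiftˡ {i} {p} {q} {a} {a′} {b} pq∈S u≤a′ v ¬v′ with b <? u
  ... | yes b<u =
    invalid-smallʳ i p q pq∈S b b<u (_ , a′ , refl , u≤a′ , ¬v′) _ a refl v
  ... | no  b≮u = ¬v′ (valid-large i p q pq∈S a′ b u≤a′ (≮⇒≥ b≮u))

  valid-shiftʳ : ∀ {i p q a b b′} → (p , q) ∈ S i → u ≤ b′ →
    Valid i (a + b + 1) p q a b → ¬ ¬ Valid i (a + b′ + 1) p q a b′
  valid-shiftʳ {i} {p} {q} {a} {b} {b′} pq∈S u≤b′ v ¬v′ with a <? u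
  ... | yes a<u =
    invalid-smallˡ i p q pq∈S a a<u (_ , b′ , refl , u≤b′ , ¬v′) _ b refl v
  ... | no  a≮u = ¬v′ (valid-large i p q pq∈S a b′ (≮⇒≥ a≮u) u≤b′)

  Nim-splits : ∀ {i n μ p q a b} → Denotes i n μ p q a b →
    Nim (result (g i n) μ) ≡ Nim (g p a ⊕ g q b)
  Nim-splits {i} {n} {μ} {p} {q} {a} {b} d =
    Nim-resp-≅ _ _ (proj₂ (proj₂ (splits i n μ p q a b d)))

  -- c is the shifted index of the large summand.
  Nim-⊆-shift : ∀ {i n n′} →
    (∀ a b → a + b + 1 ≡ n →
      (∃ λ c → u ≤ c × c + b + 1 ≡ n′ × (∀ p → Nim (g p a) ≡ Nim (g p c))) ⊎
      (∃ λ c → u ≤ c × a + c + 1 ≡ n′ × (∀ q → Nim (g q b) ≡ Nim (g q c)))) →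
    Nim (g i n) ≤ Nim (g i n′)
  Nim-⊆-shift {i} {n} {n′} shift = Nim-⊆ (g i n) (g i n′) sub
    where
    sub : ∀ μ → ¬ ¬ ∃ λ ν → Nim (result (g i n) μ) ≡ Nim (result (g i n′) ν)
    sub μ ¬∃ with denoted i n μ
    ... | p , q , a , b , d with splits i n μ p q a b d
    ... | pq∈S , refl , _ with shift a b refl
    ... | inj₁ (c , u≤c , refl , eq) =
      valid-shiftˡ pq∈S u≤c (μ , d) λ (ν , d′) → ¬∃ (ν , trans (Nim-splits d)
        (trans (Nim-⊕-congʳ (g p a) (g p c) (g q b) (eq p)) (sym (Nim-splits d′))))
    ... | inj₂ (c , u≤c , refl , eq) =
      valid-shiftʳ pq∈S u≤c (μ , d) λ (ν , d′) → ¬∃ (ν , trans (Nim-splits d)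
        (trans (Nim-⊕-congˡ (g p a) (g q b) (g q c) (eq q)) (sym (Nim-splits d′))))

  module _ (T : ℕ) where

    -- Indexed by the smaller argument: with `n` for `m + T`, the condition `u < m` is `s + 1 ≤ n`.
    Periodic : ℕ → Set
    Periodic m = u < m → ∀ i → Nim (g i (m + T)) ≡ Nim (g i m)

    periodic-step : ∀ m → (∀ {l} → l < m → Periodic l) →
      2 * (u + T) + 1 < m + T → ∀ i → Nim (g i (m + T)) ≡ Nim (g i m)
    periodic-step m IH large i =
      ≤-antisym (Nim-⊆-shift down) (Nim-⊆-shift up)
      where
      s = u + T

      -- Here `x` is the sum of the two indices of a move on a game of size `m + T`; above `2s`, one
      -- of them must exceed `s`.
      bound : ∀ {x} → x + 1 ≡ m + T → s + s < x
      bound {x} eq = +-cancelʳ-< 1 _ _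
        (subst (_< x + 1) (cong (λ y → s + y + 1) (+-identityʳ s))
          (subst (2 * s + 1 <_) (sym eq) large))

      <ˡ : ∀ {a b} → a + b + 1 ≡ m → a < m
      <ˡ {a} {b} refl = subst (a <_) (+-comm 1 (a + b)) (s≤s (m≤m+n a b))

      <ʳ : ∀ {a b} → a + b + 1 ≡ m → b < m
      <ʳ {a} {b} refl = subst (b <_) (+-comm 1 (a + b)) (s≤s (m≤n+m b a))

      unshift : ∀ {a} → s < a → ∃ λ c → u < c × c + T ≡ a
      unshift {a} s<a = a ∸ T , m+n≤o⇒m≤o∸n (suc u) s<a ,
        m∸n+n≡m (≤-trans (m≤n+m T (suc u)) s<a)

      down : ∀ a b → a + b + 1 ≡ m + T →
        (∃ λ c → u ≤ c × c + b + 1 ≡ m × (∀ p → Nim (g p a) ≡ Nim (g p c))) ⊎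
        (∃ λ c → u ≤ c × a + c + 1 ≡ m × (∀ q → Nim (g q b) ≡ Nim (g q c)))
      down a b eq with +-<-split a b (bound eq)
      ... | inj₁ s<a with unshift s<a
      ...   | c , u<c , refl =
        -- The lowered index `c` is below `m`, as `c + b + 1 ≡ m`, so `IH` applies to it.
        let eq′ = +-cancelʳ-≡ T _ _ (trans (sym (+-rotateˡ c b T)) eq)
        in inj₁ (c , <⇒≤ u<c , eq′ , IH (<ˡ eq′) u<c)
      down a b eq | inj₂ s<b with unshift s<b
      ...   | c , u<c , refl =
        let eq′ = +-cancelʳ-≡ T _ _ (trans (sym (+-rotateʳ a c T)) eq)
        in inj₂ (c , <⇒≤ u<c , eq′ , IH (<ʳ {a} eq′) u<c)

      up : ∀ a b → a + b + 1 ≡ m →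
        (∃ λ c → u ≤ c × c + b + 1 ≡ m + T × (∀ p → Nim (g p a) ≡ Nim (g p c))) ⊎
        (∃ λ c → u ≤ c × a + c + 1 ≡ m + T × (∀ q → Nim (g q b) ≡ Nim (g q c)))
      -- The bound concerns size `m + T`, so `T` is first added to `a`: either `a + T` exceeds `s`,
      -- hence `a` exceeds `u`, or `b` exceeds `s`. The large index is then raised.
      up a b eq
        with eq′ ← trans (+-rotateˡ a b T) (cong (_+ T) eq)
        with +-<-split (a + T) b (bound eq′)
      ... | inj₁ s<a+T =
        let u<a = +-cancelʳ-< T u a s<a+T
        in inj₁ (a + T , ≤-trans (<⇒≤ u<a) (m≤m+n a T) , eq′ ,
             λ p → sym (IH (<ˡ eq) u<a p))
      ... | inj₂ s<b =
        let u<b = ≤-<-trans (m≤m+n u T) s<b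
        in inj₂ (b + T , ≤-trans (<⇒≤ u<b) (m≤m+n b T) ,
             trans (+-rotateʳ a b T) (cong (_+ T) eq) ,
             λ q → sym (IH (<ʳ {a} eq) u<b q))

    periodic : (∀ m → u < m → m + T ≤ 2 * (u + T) + 1 →
        ∀ i → Nim (g i (m + T)) ≡ Nim (g i m)) →
      ∀ m → Periodic m
    periodic base = <-rec Periodic λ m IH u<m →
      [ base m u<m , periodic-step m IH ]′ (≤-<-connex (m + T) (2 * (u + T) + 1))

theorem2 : (k : ℕ) → 1 ≤ k →
    (g : Fin k → ℕ → Game)
    (S : Fin k → Pred (Fin k × Fin k) 0ℓ)
    (M : SplittingMoves g S) →
    let open SplittingMoves M using (Valid) in
    (s T : ℕ) → 1 ≤ T → T ≤ s →
    (∀ i p q → (p , q) ∈ S i → ∀ a b → s ∸ T ≤ a → s ∸ T ≤ b →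
    Valid i (a + b + 1) p q a b) →
    (∀ i p q → (p , q) ∈ S i → ∀ a → a < s ∸ T →
    (∃₂ λ n b → a + b + 1 ≡ n × s ∸ T ≤ b × ¬ Valid i n p q a b) →
    ∀ m b → a + b + 1 ≡ m → ¬ Valid i m p q a b) →
    (∀ i p q → (p , q) ∈ S i → ∀ b → b < s ∸ T →
    (∃₂ λ n a → a + b + 1 ≡ n × s ∸ T ≤ a × ¬ Valid i n p q a b) →
    ∀ m a → a + b + 1 ≡ m → ¬ Valid i m p q a b) →
    (∀ n → s + 1 ≤ n → n ≤ 2 * s + 1 → ∀ i → Nim (g i n) ≡ Nim (g i (n ∸ T))) →
    ∀ n → s + 1 ≤ n → ∀ i → Nim (g i n) ≡ Nim (g i (n ∸ T))
theorem2 k _ g S M s T _ T≤s valid smallˡ smallʳ base n s<n i =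
  -- As `T ≤ n`, the truncated subtraction is exact and `n` is `(n ∸ T) + T`.
  subst (λ x → Nim (g i x) ≡ Nim (g i (n ∸ T))) (m∸n+n≡m T≤n)
    (periodic T base′ (n ∸ T) u<n∸T i)
  where
  open Shift M (s ∸ T) valid smallˡ smallʳ

  u+T≡s : s ∸ T + T ≡ s
  u+T≡s = m∸n+n≡m T≤s

  T≤n : T ≤ n
  T≤n = ≤-trans T≤s (m+n≤o⇒m≤o s s<n)

  u<n∸T : s ∸ T < n ∸ T
  u<n∸T = ∸-monoˡ-< (subst (_≤ n) (+-comm s 1) s<n) T≤s

  base′ : ∀ m → s ∸ T < m → m + T ≤ 2 * (s ∸ T + T) + 1 →
    ∀ i → Nim (g i (m + T)) ≡ Nim (g i m)
  base′ m u<m m+T≤ j = subst (λ x → Nim (g j (m + T)) ≡ Nim (g j x)) (m+n∸n≡m m T)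
    (base (m + T)
      (subst (_≤ m + T) (trans (cong suc u+T≡s) (+-comm 1 s)) (+-monoˡ-≤ T u<m))
      (subst (λ x → m + T ≤ 2 * x + 1) u+T≡s m+T≤) j)
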